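{- Let $a\ge 2$ and $n\ge a^2$ be integers, let $b=\binom{a}{2}$ and $k=\lfloor n/(2b)\rfloor$. Then $$\frac12\binom{2k}{k}\le p(a,2,n)\le \frac{1}{2b}\binom{n}{\lceil n/a\rceil}.$$
   Context: Let $\Sigma_a=\{0,1,\ldots,a-1\}$. For $\mathbf{v}\in\Sigma_a^n$ and $r\in[n]=\{1,\ldots,n\}$, $\mathbf{v}[r]$ denotes the $r$-th coordinate of $\mathbf{v}$. A set of vectors $\mathcal{V}=\{\mathbf{v}_1,\ldots,\mathbf{v}_m\}\subseteq \Sigma_a^n$ is called $2$-wise perfect with respect to $\Sigma_a$ if (i) $|\mathcal{V}|\ge 2$, and (ii) for every pair $(\mathbf{v}_{i},\mathbf{v}_{j})$ with $1\le i<j\le m$ and every string $\alpha\in\Sigma_a^2$, there is some $r\in[n]$ with $\mathbf{v}_{i}[r]\,\mathbf{v}_{j}[r]=\alpha$. For $n\ge a^2$ (for which such sets exist), $p(a,2,n)$ denotes the maximum size of a $2$-wise perfect set of vectors of length $n$ over $\Sigma_a$. -}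

module Defs where

open import Data.Fin using (Fin; toℕ; fromℕ<; inject≤; combine; remQuot; finToFun; funToFin)
  renaming (_<_ to _<ᶠ_)
import Data.Fin as Fin
open import Data.Fin.Properties using (any?; all?; toℕ<n; toℕ-inject≤; fromℕ<-toℕ; fromℕ<-cong;
  remQuot-combine; finToFun-funToFin; injective⇒≤)
  renaming (_<?_ to _<ᶠ?_)
open import Data.List using (filter; upTo)
open import Data.List.Extrema.Nat using (max; argmax-sel; xs≤max)
import Data.List.Relation.Unary.All as ListAll
open import Data.List.Membership.Propositional.Properties using (∈-filter⁺; ∈-filter⁻; ∈-upTo⁺)
open import Data.Nat
open import Data.Nat.Combinatorics using (_C_; nCk+nC[k+1]≡[n+1]C[k+1]; nC1≡n)
open import Data.Nat.Properties
open import Data.Product using (∃; ∃-syntax; Σ; _×_; _,_; proj₁; proj₂)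
open import Data.Sum using (inj₁; inj₂)
open import Data.Vec using (Vec; []; _∷_; lookup; tabulate)
open import Data.Vec.Properties using (≡-dec; lookup∘tabulate; tabulate∘lookup; tabulate-cong)
open import Data.Vec.Relation.Unary.AllPairs using ([]; _∷_; allPairs?)
import Data.Vec.Relation.Unary.All as VecAll
open import Data.Vec.Relation.Unary.Unique.Propositional using (Unique)
open import Data.Vec.Relation.Unary.Unique.Propositional.Properties using (lookup-injective)
open import Function using (_∘_; id)
open import Relation.Binary.PropositionalEquality
open import Relation.Nullary
open import Relation.Nullary.Decidable using (map′; _×-dec_; _→-dec_; ¬?)
open import Relation.Unary using (Decidable)

-- The set {v₁, …, v_m} is given by a repetition-free enumeration of its elements.
record TwoWisePerfect {a n m : ℕ} (𝒱 : Vec (Vec (Fin a) n) m) : Set where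
  constructor mkPerfect
  field
    distinct : Unique 𝒱
    size≥2   : 2 ≤ m
    covers   : (i j : Fin m) → i <ᶠ j → (α : Vec (Fin a) 2) →
               ∃[ r ] lookup (lookup 𝒱 i) r ∷ lookup (lookup 𝒱 j) r ∷ [] ≡ α

PerfectSize : ℕ → ℕ → ℕ → Set
PerfectSize a n m = Σ (Vec (Vec (Fin a) n) m) TwoWisePerfect

Searchable : Set → Set₁
Searchable A = {P : A → Set} → Decidable P → Dec (∃ P)

searchVec : ∀ {A} → Searchable A → ∀ n → Searchable (Vec A n)
searchVec s zero    P? = map′ ([] ,_) (λ { ([] , p) → p }) (P? [])
searchVec s (suc n) P? =
  map′ (λ { (x , xs , p) → x ∷ xs , p }) (λ { (x ∷ xs , p) → x , xs , p })
       (s λ x → searchVec s n λ xs → P? (x ∷ xs))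

twoWisePerfect? : ∀ {a n m} → Decidable (TwoWisePerfect {a} {n} {m})
twoWisePerfect? {a} {n} {m} 𝒱 =
  map′ (λ { (d , s , c) → mkPerfect d s λ { i j i<j (x ∷ y ∷ []) → c i j i<j x y } })
       (λ { (mkPerfect d s c) → d , s , λ i j i<j x y → c i j i<j (x ∷ y ∷ []) })
       (allPairs? (λ v w → ¬? (≡-dec Fin._≟_ v w)) 𝒱
         ×-dec (2 ≤? m)
         ×-dec all? λ i → all? λ j → (i <ᶠ? j) →-dec
           (all? λ x → all? λ y → any? λ r →
             ≡-dec Fin._≟_ (lookup (lookup 𝒱 i) r ∷ lookup (lookup 𝒱 j) r ∷ []) (x ∷ y ∷ [])))

perfectSize? : ∀ a n → Decidable (PerfectSize a n)
perfectSize? a n m = searchVec (searchVec any? n) m twoWisePerfect?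

-- A set of vectors in Σₐⁿ has at most a ^ n elements, so restricting to sizes m ≤ a ^ n loses
-- nothing.  The value is 0 when no 2-wise perfect set exists.
p⟨_,2,_⟩ : ℕ → ℕ → ℕ
p⟨ a ,2, n ⟩ = max 0 (filter (perfectSize? a n) (upTo (suc (a ^ n))))

unique⇒≤ : ∀ {a n m} {𝒱 : Vec (Vec (Fin a) n) m} → Unique 𝒱 → m ≤ a ^ n
unique⇒≤ {a} {n} {m} {𝒱} u = injective⇒≤ {f = code ∘ lookup 𝒱} λ {i} {j} eq →
  lookup-injective u i j (code-injective eq)
  where
  code : Vec (Fin a) n → Fin (a ^ n)
  code v = funToFin (lookup v)

  code-injective : ∀ {v w} → code v ≡ code w → v ≡ w
  code-injective {v} {w} eq = begin
    v                   ≡⟨ tabulate∘lookup v ⟨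
    tabulate (lookup v) ≡⟨ tabulate-cong (λ r → trans (sym (finToFun-funToFin (lookup v) r))
                             (trans (cong (λ c → finToFun c r) eq) (finToFun-funToFin (lookup w) r))) ⟩
    tabulate (lookup w) ≡⟨ tabulate∘lookup w ⟩
    w                   ∎
    where open ≡-Reasoning

p-upperBound : ∀ {a n m} → PerfectSize a n m → m ≤ p⟨ a ,2, n ⟩
p-upperBound {a} {n} {m} s@(_ , perfect) =
  ListAll.lookup (xs≤max 0 _)
    (∈-filter⁺ (perfectSize? a n) (∈-upTo⁺ (s≤s (unique⇒≤ (TwoWisePerfect.distinct perfect)))) s)

p-attained : ∀ {a n m} → PerfectSize a n m → PerfectSize a n p⟨ a ,2, n ⟩
p-attained {a} {n} {m} s@(_ , perfect)
  with argmax-sel id 0 (filter (perfectSize? a n) (upTo (suc (a ^ n))))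
... | inj₂ p∈sizes = proj₂ (∈-filter⁻ (perfectSize? a n) {xs = upTo (suc (a ^ n))} p∈sizes)
... | inj₁ p≡0     = contradiction
  (≤-trans (TwoWisePerfect.size≥2 perfect) (subst (m ≤_) p≡0 (p-upperBound s))) λ ()

-- For n ≥ a², the vectors listing the first and second letters of all α ∈ Σₐ², padded by zeros,
-- form a 2-wise perfect set.
perfectPair : ∀ {a n} → 2 ≤ a → a ^ 2 ≤ n → PerfectSize a n 2
perfectPair {a@(suc (suc _))} {n} (s≤s (s≤s _)) a²≤n = 𝒱 , mkPerfect distinct ≤-refl covers
  where
  a*a≤n : a * a ≤ n
  a*a≤n = subst (_≤ n) (cong (a *_) (*-identityʳ a)) a²≤n

  letters : Fin n → Fin a × Fin a
  letters r with toℕ r <? a * a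
  ... | yes r<a*a = remQuot a (fromℕ< r<a*a)
  ... | no _      = Fin.zero , Fin.zero

  position : Fin a → Fin a → Fin n
  position x y = inject≤ (combine x y) a*a≤n

  letters-position : ∀ x y → letters (position x y) ≡ (x , y)
  letters-position x y with toℕ (position x y) <? a * a
  ... | yes r<a*a = trans (cong (remQuot a)
          (trans (fromℕ<-cong _ _ (toℕ-inject≤ (combine x y) a*a≤n) r<a*a (toℕ<n (combine x y)))
                 (fromℕ<-toℕ (combine x y) (toℕ<n (combine x y)))))
          (remQuot-combine x y)
  ... | no r≮a*a  = contradiction
          (subst (_< a * a) (sym (toℕ-inject≤ (combine x y) a*a≤n)) (toℕ<n (combine x y))) r≮a*a

  v w : Vec (Fin a) n
  v = tabulate (proj₁ ∘ letters)
  w = tabulate (proj₂ ∘ letters)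

  𝒱 : Vec (Vec (Fin a) n) 2
  𝒱 = v ∷ w ∷ []

  v-position : ∀ x y → lookup v (position x y) ≡ x
  v-position x y = trans (lookup∘tabulate (proj₁ ∘ letters) (position x y)) (cong proj₁ (letters-position x y))

  w-position : ∀ x y → lookup w (position x y) ≡ y
  w-position x y = trans (lookup∘tabulate (proj₂ ∘ letters) (position x y)) (cong proj₂ (letters-position x y))

  0≢1 : Fin.zero ≢ Fin.suc {suc _} Fin.zero
  0≢1 ()

  v≢w : v ≢ w
  v≢w v≡w = 0≢1 (trans (sym (v-position Fin.zero (Fin.suc Fin.zero)))
    (trans (cong (λ u → lookup u (position Fin.zero (Fin.suc Fin.zero))) v≡w)
           (w-position Fin.zero (Fin.suc Fin.zero))))

  distinct : Unique 𝒱
  distinct = (v≢w VecAll.∷ VecAll.[]) ∷ VecAll.[] ∷ []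

  covers : (i j : Fin 2) → i <ᶠ j → (α : Vec (Fin a) 2) →
           ∃[ r ] lookup (lookup 𝒱 i) r ∷ lookup (lookup 𝒱 j) r ∷ [] ≡ α
  covers Fin.zero           (Fin.suc Fin.zero) _ (x ∷ y ∷ []) =
    position x y , cong₂ (λ x y → x ∷ y ∷ []) (v-position x y) (w-position x y)
  covers Fin.zero           Fin.zero           ()
  covers (Fin.suc Fin.zero) Fin.zero           ()
  covers (Fin.suc Fin.zero) (Fin.suc Fin.zero) (s≤s ())

p-isMaximum : ∀ {a n} → 2 ≤ a → a ^ 2 ≤ n →
              PerfectSize a n p⟨ a ,2, n ⟩ × (∀ m → PerfectSize a n m → m ≤ p⟨ a ,2, n ⟩)
p-isMaximum 2≤a a²≤n = p-attained (perfectPair 2≤a a²≤n) , λ _ → p-upperBound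

⌈_/_⌉ : (n d : ℕ) .{{_ : NonZero d}} → ℕ
⌈ n / d ⌉ = (n + (d ∸ 1)) / d

2≤a⇒a≢0 : ∀ {a} → 2 ≤ a → NonZero a
2≤a⇒a≢0 2≤a = >-nonZero (<⇒≤ 2≤a)

2≤a⇒2b≢0 : ∀ {a} → 2 ≤ a → NonZero (2 * (a C 2))
2≤a⇒2b≢0 {suc a} (s≤s 1≤a) = m*n≢0 2 (suc a C 2) {{_}} {{>-nonZero (begin
  1             ≤⟨ 1≤a ⟩
  a             ≡⟨ nC1≡n a ⟨
  a C 1         ≤⟨ m≤m+n (a C 1) (a C 2) ⟩
  a C 1 + a C 2 ≡⟨ nCk+nC[k+1]≡[n+1]C[k+1] a 1 ⟩
  suc a C 2     ∎)}}
  where open ≤-Reasoning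

{-# OPTIONS --safe #-}
module Submission where

-- Upper bound.  Given a vector v of a 2-wise perfect set, let X and Y be its two smallest letter
-- classes, of sizes p ≤ q.  The pairs (X , Y) and (Y , X), taken over all v, satisfy the hypothesis
-- of Bollobás's set-pair inequality: a linear order of the coordinates has "X before Y" for at most
-- one of them.  Such a pair accounts for a fraction 1 / C(p+q, p) of all orders.  As a (p + q) ≤ 2n,
-- and p ≥ a because X meets every class of another vector,
-- C(n, p) / C(p+q, p) ≥ (a / 2)^p ≥ C(a, 2), and C(n, p) ≤ C(n, ⌈n/a⌉) by unimodality.
--
-- Lower bound.  Reserve 2k coordinates for each of the C(a, 2) pairs {x , y} of letters.  Each
-- k-subset of a 2k-set that contains a fixed point gives a vector, which in the block of {x , y} has
-- x on the subset and y off it.  Two such subsets S ≠ T leave all four of S ∩ T, S \ T, T \ S and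
-- the complement of S ∪ T nonempty.

open import Defs
open import Data.Bool using (Bool; true; false; if_then_else_)
open import Data.Fin using (Fin; combine; inject≤; punchIn; punchOut; remQuot; toℕ) renaming (_<_ to _<ᶠ_)
import Data.Fin as Fin
import Data.Fin.Properties as Finₚ
open import Data.Fin.Subset using (Subset; inside; outside; ∣_∣)
open import Data.Integer using (+_)
import Data.Integer as ℤ
import Data.Integer.Properties as ℤₚ
open import Data.List using (List; []; _∷_; _++_; allFin; length)
import Data.List as List
open import Data.List.Membership.Propositional using (_∈_)
open import Data.List.Membership.Propositional.Properties using (∈-++⁺ˡ; ∈-++⁺ʳ; ∈-allFin; ∈-lookup; ∈-map⁺; ∈-map⁻)
open import Data.List.Properties using (length-++; length-map; length-tabulate)
open import Data.List.Relation.Unary.All using (All; []; _∷_)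
import Data.List.Relation.Unary.All as All
import Data.List.Relation.Unary.All.Properties as Allₚ
open import Data.List.Relation.Unary.AllPairs using (AllPairs; []; _∷_)
import Data.List.Relation.Unary.AllPairs.Properties as AllPairsₚ
import Data.List.Relation.Unary.Any as Any
import Data.List.Relation.Unary.Any.Properties as Anyₚ
open import Data.List.Relation.Unary.Unique.Propositional using (Unique)
import Data.List.Relation.Unary.Unique.Propositional.Properties as Uniqueₚ
open import Data.Nat
open import Data.Nat.Combinatorics using (_C_; nC1≡n; nCk+nC[k+1]≡[n+1]C[k+1]; nCk≡nC[n∸k])
open import Data.Nat.DivMod using (/-monoˡ-≤; m*n/n≡m; m/n*n≤m; m<n⇒m%n≡m; _mod_)
open import Data.Nat.Properties
open import Data.Nat.Tactic.RingSolver using (solve-∀)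
open import Data.Product using (∃-syntax; _×_; _,_; proj₁; proj₂)
import Data.Product as Product
open import Data.Rational using (½; toℚᵘ) renaming (_/_ to _/ℚ_; _*_ to _*ℚ_; _≤_ to _≤ℚ_)
import Data.Rational.Properties as ℚₚ
open import Data.Rational.Unnormalised using (mkℚᵘ; *≤*) renaming (_≃_ to _≃ᵘ_)
import Data.Rational.Unnormalised.Properties as ℚᵘₚ
open import Data.Sum using (inj₁; inj₂)
open import Data.Vec using (Vec; []; _∷_; lookup; tabulate)
open import Data.Vec.Functional using (Vector; removeAt)
open import Data.Vec.Properties using (∷-injectiveʳ; lookup∘tabulate)
import Data.Vec.Relation.Unary.Unique.Propositional.Properties as VecUniqueₚ
open import Function using (_∘_; _∋_)
open import Relation.Binary.Definitions using (tri<; tri≈; tri>)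
open import Relation.Binary.PropositionalEquality
open import Relation.Nullary

open import Algebra.Properties.Semiring.Sum +-*-semiring
  using (sum; sum-cong-≗; sum-remove; sum-replicate-zero; ∑-comm; ∑-distrib-+; *-distribˡ-sum; *-distribʳ-sum)

-- Binomial coefficients

-- The absorption identity, by induction through Pascal's rule. The inequalities between binomial
-- coefficients below rest on it.
[k+1]*[n+1]C[k+1]≡[n+1]*nCk : ∀ n k → suc k * (suc n C suc k) ≡ suc n * (n C k)
[k+1]*[n+1]C[k+1]≡[n+1]*nCk n zero = begin
  1 * (suc n C 1) ≡⟨ *-identityˡ (suc n C 1) ⟩
  suc n C 1       ≡⟨ nC1≡n (suc n) ⟩
  suc n           ≡⟨ *-identityʳ (suc n) ⟨
  suc n * 1       ∎
  where open ≡-Reasoning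
[k+1]*[n+1]C[k+1]≡[n+1]*nCk zero (suc k) = *-zeroʳ (2 + k)
[k+1]*[n+1]C[k+1]≡[n+1]*nCk (suc n) (suc k) = begin
  suc (suc k) * (suc (suc n) C suc (suc k))
    ≡⟨ cong (suc (suc k) *_) (nCk+nC[k+1]≡[n+1]C[k+1] (suc n) (suc k)) ⟨
  suc (suc k) * (x + y)
    ≡⟨ expand k x y ⟩
  x + (suc k * x + suc (suc k) * y)
    ≡⟨ cong (_+_ x) (cong₂ _+_ ([k+1]*[n+1]C[k+1]≡[n+1]*nCk n k) ([k+1]*[n+1]C[k+1]≡[n+1]*nCk n (suc k))) ⟩
  x + (suc n * (n C k) + suc n * (n C suc k))
    ≡⟨ cong (_+_ x) (*-distribˡ-+ (suc n) (n C k) (n C suc k)) ⟨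
  x + suc n * (n C k + n C suc k)
    ≡⟨ cong (λ z → x + suc n * z) (nCk+nC[k+1]≡[n+1]C[k+1] n k) ⟩
  suc (suc n) * x ∎
  where
  open ≡-Reasoning
  x y : ℕ
  x = suc n C suc k
  y = suc n C suc (suc k)

  expand : ∀ k x y → suc (suc k) * (x + y) ≡ x + (suc k * x + suc (suc k) * y)
  expand = solve-∀

[p+q]Cp*p!*q!≡[p+q]! : ∀ p q → ((p + q) C p) * (p ! * q !) ≡ (p + q) !
[p+q]Cp*p!*q!≡[p+q]! zero    q = trans (*-identityˡ (1 * q !)) (*-identityˡ (q !))
[p+q]Cp*p!*q!≡[p+q]! (suc p) q = begin
  (suc (p + q) C suc p) * (suc p * p ! * q !)     ≡⟨ regroup (suc (p + q) C suc p) (suc p) (p !) (q !) ⟩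
  suc p * (suc (p + q) C suc p) * (p ! * q !)     ≡⟨ cong (_* (p ! * q !)) ([k+1]*[n+1]C[k+1]≡[n+1]*nCk (p + q) p) ⟩
  suc (p + q) * ((p + q) C p) * (p ! * q !)       ≡⟨ *-assoc (suc (p + q)) ((p + q) C p) (p ! * q !) ⟩
  suc (p + q) * (((p + q) C p) * (p ! * q !))     ≡⟨ cong (suc (p + q) *_) ([p+q]Cp*p!*q!≡[p+q]! p q) ⟩
  suc (p + q) * (p + q) !                         ∎
  where
  open ≡-Reasoning
  regroup : ∀ c s x y → c * (s * x * y) ≡ s * c * (x * y)
  regroup = solve-∀

-- With `n C k` added to both sides, Pascal's rule turns the right one into `suc n C suc k`, which
-- by absorption is (n+1)/(k+1) ≥ 2 times `n C k`. This avoids the factor n - k and its truncated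
-- subtraction.
nCk≤nC[k+1] : ∀ {n k} → 2 * suc k ≤ suc n → n C k ≤ n C suc k
nCk≤nC[k+1] {n} {k} h = +-cancelˡ-≤ (n C k) (n C k) (n C suc k) (*-cancelˡ-≤ (suc k) (begin
  suc k * (n C k + n C k)     ≡⟨ double (suc k) (n C k) ⟩
  2 * suc k * (n C k)         ≤⟨ *-monoˡ-≤ (n C k) h ⟩
  suc n * (n C k)             ≡⟨ [k+1]*[n+1]C[k+1]≡[n+1]*nCk n k ⟨
  suc k * (suc n C suc k)     ≡⟨ cong (suc k *_) (nCk+nC[k+1]≡[n+1]C[k+1] n k) ⟨
  suc k * (n C k + n C suc k) ∎))
  where
  open ≤-Reasoning
  double : ∀ k c → k * (c + c) ≡ 2 * k * c
  double = solve-∀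

C-monoʳ-≤ : ∀ {n i m} → i ≤ m → 2 * m ≤ suc n → n C i ≤ n C m
C-monoʳ-≤ {n} {i} i≤m = go (≤⇒≤′ i≤m)
  where
  go : ∀ {m} → i ≤′ m → 2 * m ≤ suc n → n C i ≤ n C m
  go ≤′-refl            _ = ≤-refl
  go (≤′-step {m} i≤′m) h =
    ≤-trans (go i≤′m (≤-trans (*-monoʳ-≤ 2 (n≤1+n m)) h)) (nCk≤nC[k+1] h)

-- The quotient (n C p) / (s C p) is a product of p factors (n - i) / (s - i) ≥ n / s ≥ a / 2.
a^p*sCp≤2^p*nCp : ∀ {a} → 2 ≤ a → ∀ p s n → a * s ≤ 2 * n → a ^ p * (s C p) ≤ 2 ^ p * (n C p)
a^p*sCp≤2^p*nCp _ zero    s       n       _ = ≤-refl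
a^p*sCp≤2^p*nCp {a} _ (suc p) zero n      _ = subst (_≤ 2 ^ suc p * (n C suc p)) (sym (*-zeroʳ (a ^ suc p))) z≤n
a^p*sCp≤2^p*nCp {suc a} 2≤a (suc p) (suc s) zero ()
a^p*sCp≤2^p*nCp {a} 2≤a (suc p) (suc s) (suc n) h = *-cancelˡ-≤ (suc p) (begin
  suc p * (a * a ^ p * (suc s C suc p))   ≡⟨ regroup (suc p) a (a ^ p) (suc s C suc p) ⟩
  a * a ^ p * (suc p * (suc s C suc p))   ≡⟨ cong (a * a ^ p *_) ([k+1]*[n+1]C[k+1]≡[n+1]*nCk s p) ⟩
  a * a ^ p * (suc s * (s C p))           ≡⟨ interchange a (a ^ p) (suc s) (s C p) ⟩
  a * suc s * (a ^ p * (s C p))           ≤⟨ *-mono-≤ h (a^p*sCp≤2^p*nCp 2≤a p s n h′) ⟩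
  2 * suc n * (2 ^ p * (n C p))           ≡⟨ interchange 2 (2 ^ p) (suc n) (n C p) ⟨
  2 * 2 ^ p * (suc n * (n C p))           ≡⟨ cong (2 * 2 ^ p *_) ([k+1]*[n+1]C[k+1]≡[n+1]*nCk n p) ⟨
  2 * 2 ^ p * (suc p * (suc n C suc p))   ≡⟨ regroup (suc p) 2 (2 ^ p) (suc n C suc p) ⟨
  suc p * (2 * 2 ^ p * (suc n C suc p))   ∎)
  where
  open ≤-Reasoning
  regroup : ∀ p a b c → p * (a * b * c) ≡ a * b * (p * c)
  regroup = solve-∀

  interchange : ∀ a b c d → a * b * (c * d) ≡ a * c * (b * d)
  interchange = solve-∀

  h′ : a * s ≤ 2 * n
  h′ = +-cancelˡ-≤ a (a * s) (2 * n) (begin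
    a + a * s   ≡⟨ *-suc a s ⟨
    a * suc s   ≤⟨ h ⟩
    2 * suc n   ≡⟨ *-suc 2 n ⟩
    2 + 2 * n   ≤⟨ +-monoˡ-≤ (2 * n) 2≤a ⟩
    a + 2 * n   ∎)

2*[a+1]C2≡[a+1]*a : ∀ a → 2 * (suc a C 2) ≡ suc a * a
2*[a+1]C2≡[a+1]*a a = trans ([k+1]*[n+1]C[k+1]≡[n+1]*nCk a 1) (cong (suc a *_) (nC1≡n a))

-- For a = 2 both sides agree. For a ≥ 3 also p ≥ 3, and three of the p factors suffice: 8 C(a,2) =
-- 4a(a-1) ≤ a³. The other factors only need 2 ≤ a.
2^p*aC2≤a^p : ∀ {a p} → 2 ≤ a → a ≤ p → 2 ^ p * (a C 2) ≤ a ^ p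
2^p*aC2≤a^p {1} (s≤s ()) _
2^p*aC2≤a^p {2} {p} _ _ = ≤-reflexive (*-identityʳ (2 ^ p))
2^p*aC2≤a^p {suc (suc (suc c))} {suc (suc (suc t))} _ (s≤s (s≤s (s≤s _))) = begin
  2 * (2 * (2 * 2 ^ t)) * (a C 2)  ≡⟨ regroup (2 ^ t) (a C 2) ⟩
  2 ^ t * (4 * (2 * (a C 2)))      ≡⟨ cong (λ z → 2 ^ t * (4 * z)) (2*[a+1]C2≡[a+1]*a (2 + c)) ⟩
  2 ^ t * (4 * (a * (2 + c)))      ≤⟨ *-mono-≤ (^-monoˡ-≤ t {2} {a} (s≤s (s≤s z≤n))) cube ⟩
  a ^ t * (a * (a * a))            ≡⟨ regroup′ a (a ^ t) ⟩
  a * (a * (a * a ^ t))            ∎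
  where
  open ≤-Reasoning
  a : ℕ
  a = suc (suc (suc c))

  regroup : ∀ x y → 2 * (2 * (2 * x)) * y ≡ x * (4 * (2 * y))
  regroup = solve-∀

  regroup′ : ∀ a x → x * (a * (a * a)) ≡ a * (a * (a * x))
  regroup′ = solve-∀

  -- 4 (a - 1) ≤ a², because (a - 2)² ≥ 0.
  square : ∀ c → (3 + c) * ((3 + c) * (3 + c)) ≡ 4 * ((3 + c) * (2 + c)) + (3 + c) * ((1 + c) * (1 + c))
  square = solve-∀

  cube : 4 * (a * (2 + c)) ≤ a * (a * a)
  cube = subst (4 * (a * (2 + c)) ≤_) (sym (square c)) (m≤m+n _ _)

-- The set-pair inequality

sum-mono-≤ : ∀ {n} {f g : Vector ℕ n} → (∀ r → f r ≤ g r) → sum f ≤ sum g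
sum-mono-≤ {zero}  f≤g = z≤n
sum-mono-≤ {suc n} f≤g = +-mono-≤ (f≤g Fin.zero) (sum-mono-≤ (f≤g ∘ Fin.suc))

sum-const : ∀ n c → sum {n} (λ _ → c) ≡ n * c
sum-const zero    c = refl
sum-const (suc n) c = cong (_+_ c) (sum-const n c)

𝟙 : ∀ {P : Set} → Dec P → ℕ
𝟙 (yes _) = 1
𝟙 (no  _) = 0

occ : ∀ {a n} → Fin a → Vector (Fin a) n → ℕ
occ x v = sum λ r → 𝟙 (v r Fin.≟ x)

occ-remove : ∀ {a n} (x : Fin a) (v : Vector (Fin a) (suc n)) r →
             occ x v ≡ 𝟙 (v r Fin.≟ x) + occ x (removeAt v r)
occ-remove x v r = sum-remove {i = r} λ r → 𝟙 (v r Fin.≟ x)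

occ>0 : ∀ {a n} {x : Fin a} (v : Vector (Fin a) n) {r} → v r ≡ x → 0 < occ x v
occ>0 {n = suc n} {x} v {r} vr≡x rewrite occ-remove x v r with v r Fin.≟ x
... | yes _   = s≤s z≤n
... | no vr≢x = contradiction vr≡x vr≢x

-- The number of linear orders of the n coordinates in which all occurrences of x precede all
-- occurrences of y: an order is its first coordinate r together with an order of the others.
orders     : ∀ {a n} → Fin a → Fin a → Vector (Fin a) n → ℕ
ordersFrom : ∀ {a n} → Fin a → Fin a → Vector (Fin a) (suc n) → Fin (suc n) → ℕ

orders {n = zero}  x y v = 1
orders {n = suc n} x y v with occ x v
... | zero  = suc n !
... | suc _ = sum (ordersFrom x y v)

ordersFrom x y v r with v r Fin.≟ y
... | yes _ = 0
... | no  _ = orders x y (removeAt v r)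

-- Among the (p+q)! relative orders of the coordinates carrying `x` or `y`, exactly p! q! put every
-- `x` first. The proof is an induction on n by the first coordinate, and the product form avoids
-- division.
orders-value : ∀ {a n} {x y : Fin a} {v : Vector (Fin a) n} {p q} → x ≢ y → occ x v ≡ p → occ y v ≡ q →
               orders x y v * (p + q) ! ≡ p ! * q ! * n !
orders-value {n = zero} x≢y refl refl = refl
orders-value {n = suc n} {x} {y} {v} {q = q} x≢y occx occy with occ x v in eqx
-- No `x` occurs, so the condition is vacuous and `orders` counts all orders without recursing.
orders-value {n = suc n} {q = q} x≢y refl occy | zero = begin
  suc n ! * q !     ≡⟨ *-comm (suc n !) (q !) ⟩
  q ! * suc n !     ≡⟨ cong (_* suc n !) (*-identityˡ (q !)) ⟨
  1 * q ! * suc n ! ∎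
  where open ≡-Reasoning
orders-value {a} {suc n} {x} {y} {v} {q = q} x≢y refl occy | suc p =
  +-cancelʳ-≡ (suc p * X + q * X) _ _ (begin
    sum (ordersFrom x y v) * F + (suc p * X + q * X)
      ≡⟨ cong₂ _+_ (*-distribʳ-sum F (ordersFrom x y v))
           (cong₂ _+_ (trans (cong (_* X) (sym eqx)) (*-distribʳ-sum X δx))
                  (trans (cong (_* X) (sym occy)) (*-distribʳ-sum X δy))) ⟩
    sum oF + (sum (λ r → δx r * X) + sum (λ r → δy r * X))
      ≡⟨ trans (∑-distrib-+ oF (λ r → δx r * X + δy r * X))
           (cong (_+_ (sum oF)) (∑-distrib-+ (λ r → δx r * X) (λ r → δy r * X))) ⟨
    sum (λ r → ordersFrom x y v r * F + (δx r * X + δy r * X))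
      ≡⟨ sum-cong-≗ first ⟩
    sum (λ r → δx r * Y + X)
      ≡⟨ ∑-distrib-+ (λ r → δx r * Y) (λ _ → X) ⟩
    sum (λ r → δx r * Y) + sum {suc n} (λ _ → X)
      ≡⟨ cong₂ _+_ (trans (sym (*-distribʳ-sum Y δx)) (cong (_* Y) eqx)) (sum-const (suc n) X) ⟩
    suc p * Y + suc n * X
      ≡⟨ rearrange p q (p !) (q !) n (n !) ⟩
    suc p ! * q ! * suc n ! + (suc p * X + q * X) ∎)
  where
  open ≡-Reasoning

  F X Y : ℕ
  F = (suc p + q) !
  X = suc p ! * q ! * n !
  Y = (suc p + q) * (p ! * q ! * n !)

  oF δx δy : Vector ℕ (suc n)
  oF r = ordersFrom x y v r * F
  δx r = 𝟙 (v r Fin.≟ x)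
  δy r = 𝟙 (v r Fin.≟ y)

  rearrange : ∀ p q p! q! n n! →
    suc p * ((suc p + q) * (p! * q! * n!)) + suc n * (suc p * p! * q! * n!) ≡
    suc p * p! * q! * (suc n * n!) + (suc p * (suc p * p! * q! * n!) + q * (suc p * p! * q! * n!))
  rearrange = solve-∀

  -- The δ-terms on the left avoid the number 1 + n - (1 + p + q) of coordinates that are neither x nor y.
  first : ∀ r → ordersFrom x y v r * F + (δx r * X + δy r * X) ≡ δx r * Y + X
  first r with v r Fin.≟ x | v r Fin.≟ y | occ-remove x v r | occ-remove y v r
  ... | yes vr≡x | yes vr≡y | _ | _ = contradiction (trans (sym vr≡x) vr≡y) x≢y
  ... | yes _    | no _     | ox | oy = begin
    o * F + (1 * X + 0)                        ≡⟨ cong (_+ (1 * X + 0)) (x*[y*z]≡y*[x*z] o (suc p + q) ((p + q) !)) ⟩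
    (suc p + q) * (o * (p + q) !) + (1 * X + 0) ≡⟨ cong (λ z → (suc p + q) * z + (1 * X + 0))
                                                     (orders-value {v = removeAt v r} x≢y
                                                       (suc-injective (trans (sym ox) eqx)) (trans (sym oy) occy)) ⟩
    Y + (1 * X + 0)                            ≡⟨ tidy Y X ⟩
    1 * Y + X                                  ∎
    where
    o : ℕ
    o = orders x y (removeAt v r)
    x*[y*z]≡y*[x*z] : ∀ x y z → x * (y * z) ≡ y * (x * z)
    x*[y*z]≡y*[x*z] = solve-∀
    tidy : ∀ Y X → Y + (1 * X + 0) ≡ 1 * Y + X
    tidy = solve-∀
  ... | no _     | yes _    | _  | _  = +-identityʳ X
  ... | no _     | no _     | ox | oy =
    trans (+-identityʳ _) (orders-value {v = removeAt v r} x≢y (trans (sym ox) eqx) (trans (sym oy) occy))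

ordersFrom≤ : ∀ {a n} (x y : Fin a) (v : Vector (Fin a) (suc n)) r → ordersFrom x y v r ≤ n !
orders≤ : ∀ {a n} (x y : Fin a) (v : Vector (Fin a) n) → orders x y v ≤ n !

ordersFrom≤ x y v r with v r Fin.≟ y
... | yes _ = z≤n
... | no  _ = orders≤ x y (removeAt v r)

orders≤ {n = zero}  x y v = ≤-refl
orders≤ {n = suc n} x y v with occ x v
... | zero  = ≤-refl
... | suc _ = ≤-trans (sum-mono-≤ (ordersFrom≤ x y v)) (≤-reflexive (sum-const (suc n) (n !)))

-- (x , y , v) stands for the pair of disjoint sets v⁻¹(x), v⁻¹(y).
SetPair : ℕ → ℕ → Set
SetPair a n = Fin a × Fin a × Vector (Fin a) n

-- The hypothesis of the set-pair inequality, for (X , Y) and (X′ , Y′). Take s in X ∩ Y′ and t in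
-- X′ ∩ Y: "X before Y" puts s before t, while "X′ before Y′" puts t before s, so no order satisfies
-- both.
Cross : ∀ {a n} → SetPair a n → SetPair a n → Set
Cross (x , y , v) (x′ , y′ , w) = (∃[ r ] v r ≡ x × w r ≡ y′) × (∃[ r ] w r ≡ x′ × v r ≡ y)

totalOrders : ∀ {a n} → List (SetPair a n) → ℕ
totalOrders []                 = 0
totalOrders ((x , y , v) ∷ us) = orders x y v + totalOrders us

totalOrdersFrom : ∀ {a n} → List (SetPair a (suc n)) → Fin (suc n) → ℕ
totalOrdersFrom []                 r = 0
totalOrdersFrom ((x , y , v) ∷ us) r = ordersFrom x y v r + totalOrdersFrom us r

-- The set pairs still to be satisfied once `r` comes first. A pair whose second set contains `r` is
-- dropped, matching the value 0 of `ordersFrom`.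
startingAt : ∀ {a n} → Fin (suc n) → List (SetPair a (suc n)) → List (SetPair a n)
startingAt r [] = []
startingAt r ((x , y , v) ∷ us) with v r Fin.≟ y
... | yes _ = startingAt r us
... | no  _ = (x , y , removeAt v r) ∷ startingAt r us

totalOrdersFrom≡ : ∀ {a n} (us : List (SetPair a (suc n))) r → totalOrdersFrom us r ≡ totalOrders (startingAt r us)
totalOrdersFrom≡ []                 r = refl
totalOrdersFrom≡ ((x , y , v) ∷ us) r with v r Fin.≟ y
... | yes _ = totalOrdersFrom≡ us r
... | no  _ = cong (_+_ (orders x y (removeAt v r))) (totalOrdersFrom≡ us r)

removeAt-witness : ∀ {a n} {x y : Fin a} {v w : Vector (Fin a) (suc n)} {r} → w r ≢ y →
                   ∃[ s ] v s ≡ x × w s ≡ y → ∃[ s ] removeAt v r s ≡ x × removeAt w r s ≡ y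
removeAt-witness {y = y} {v} {w} {r} wr≢y (s , vs≡x , ws≡y) =
  punchOut r≢s , trans (cong v (Finₚ.punchIn-punchOut r≢s)) vs≡x , trans (cong w (Finₚ.punchIn-punchOut r≢s)) ws≡y
  where
  r≢s : r ≢ s
  r≢s r≡s = wr≢y (trans (cong w r≡s) ws≡y)

-- Each witness of crossing lies in the second set of one of the two pairs. Surviving pairs do not
-- have `r` in their second set, so `r` is no witness and its removal does no harm.
startingAt-cross : ∀ {a n r} {us : List (SetPair a (suc n))} → AllPairs Cross us → AllPairs Cross (startingAt r us)
startingAt-cross [] = []
startingAt-cross {a} {n} {r} {us = (x , y , v) ∷ _} (cross ∷ crosses) with v r Fin.≟ y
... | yes _    = startingAt-cross crosses
... | no vr≢y  = head cross ∷ startingAt-cross crosses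
  where
  head : ∀ {us} → All (Cross (x , y , v)) us → All (Cross (x , y , removeAt v r)) (startingAt r us)
  head [] = []
  head {(x′ , y′ , w) ∷ _} ((c , c′) ∷ cs) with w r Fin.≟ y′
  ... | yes _    = head cs
  ... | no wr≢y′ = (removeAt-witness wr≢y′ c , removeAt-witness vr≢y c′) ∷ head cs

-- Nonempty first sets are required because `orders` splits by the first coordinate only when `x`
-- occurs.
totalOrders-first : ∀ {a n} {us : List (SetPair a (suc n))} →
                    All (λ { (x , y , v) → 0 < occ x v }) us → totalOrders us ≡ sum (totalOrdersFrom us)
totalOrders-first {n = n} [] = sym (sum-replicate-zero (suc n))
totalOrders-first {us = (x , y , v) ∷ us} (occ>0 ∷ occs>0) = begin
  orders x y v + totalOrders us                          ≡⟨ cong₂ _+_ (step occ>0) (totalOrders-first occs>0) ⟩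
  sum (ordersFrom x y v) + sum (totalOrdersFrom us)      ≡⟨ ∑-distrib-+ (ordersFrom x y v) (totalOrdersFrom us) ⟨
  sum (λ r → ordersFrom x y v r + totalOrdersFrom us r)  ∎
  where
  open ≡-Reasoning
  step : 0 < occ x v → orders x y v ≡ sum (ordersFrom x y v)
  step h with occ x v
  ... | suc _ = refl

-- That no order serves two crossing pairs is proved as a count, without representing orders: for
-- each first coordinate the surviving pairs still cross, so by induction they share at most (n-1)!
-- continuations.
totalOrders≤ : ∀ {a n} {us : List (SetPair a n)} → AllPairs Cross us → totalOrders us ≤ n !
totalOrders≤ [] = z≤n
-- A lone pair has no partner to guarantee that `x` occurs, so it is bounded directly.
totalOrders≤ {us = (x , y , v) ∷ []} (_ ∷ []) = ≤-trans (≤-reflexive (+-identityʳ _)) (orders≤ x y v)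
totalOrders≤ {n = zero} {_ ∷ _ ∷ _} ((((() , _) , _) ∷ _) ∷ _)
totalOrders≤ {n = suc n} {us@((_ , _ , v) ∷ _ ∷ _)} crosses@(crossHead@(((_ , vr≡x , _) , _) ∷ _) ∷ _) = begin
  -- The head crosses every other pair, which makes all first sets nonempty, its own included.
  totalOrders us                            ≡⟨ totalOrders-first {us = us} (occ>0 v vr≡x ∷ All.map first-occurs crossHead) ⟩
  sum (totalOrdersFrom us)                  ≡⟨ sum-cong-≗ (totalOrdersFrom≡ us) ⟩
  sum (λ r → totalOrders (startingAt r us)) ≤⟨ sum-mono-≤ (λ r → totalOrders≤ (startingAt-cross {r = r} crosses)) ⟩
  sum {suc n} (λ _ → n !)                   ≡⟨ sum-const (suc n) (n !) ⟩
  suc n !                                   ∎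
  where
  open ≤-Reasoning
  first-occurs : ∀ {t u : SetPair _ (suc n)} → Cross t u → let (x′ , _ , w) = u in 0 < occ x′ w
  first-occurs {u = _ , _ , w} (_ , _ , wr≡x′ , _) = occ>0 w wr≡x′

-- Each pair claims at least the fraction K / M of all n! orders, and these shares add up to at most
-- 1.
bollobás : ∀ {a n} M K {us : List (SetPair a n)} → AllPairs Cross us →
           All (λ { (x , y , v) → K * n ! ≤ M * orders x y v }) us → length us * K ≤ M
bollobás {n = n} M K {us} crosses large = *-cancelʳ-≤ (length us * K) M (n !) {{n !≢0}} (begin
  length us * K * n !   ≡⟨ *-assoc (length us) K (n !) ⟩
  length us * (K * n !) ≤⟨ sum-large large ⟩
  M * totalOrders us    ≤⟨ *-monoʳ-≤ M (totalOrders≤ crosses) ⟩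
  M * n !               ∎)
  where
  open ≤-Reasoning
  sum-large : ∀ {us} → All (λ { (x , y , v) → K * n ! ≤ M * orders x y v }) us →
              length us * (K * n !) ≤ M * totalOrders us
  sum-large [] = z≤n
  sum-large {(x , y , v) ∷ us} (l ∷ ls) =
    ≤-trans (+-mono-≤ l (sum-large ls)) (≤-reflexive (sym (*-distribˡ-+ M (orders x y v) (totalOrders us))))

-- The upper bound

sum-𝟙 : ∀ {a} (i : Fin a) → sum (λ x → 𝟙 (i Fin.≟ x)) ≡ 1
sum-𝟙 {suc a} Fin.zero    = cong suc (sum-replicate-zero a)
sum-𝟙 {suc a} (Fin.suc i) = trans (sum-cong-≗ 𝟙-suc) (sum-𝟙 i)
  where
  𝟙-suc : ∀ x → 𝟙 (Fin.suc i Fin.≟ Fin.suc x) ≡ 𝟙 (i Fin.≟ x)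
  𝟙-suc x with i Fin.≟ x
  ... | yes _ = refl
  ... | no  _ = refl

-- Every coordinate carries exactly one letter of `v`, so splitting a weight by letters preserves
-- its total. Constant weight 1 gives `sum-occ`; the indicator of a letter class of another vector
-- gives `covered⇒a≤occ`.
sum-by-letter : ∀ {a n} (f : Vector ℕ n) (v : Vector (Fin a) n) →
                sum (λ x → sum (λ r → f r * 𝟙 (v r Fin.≟ x))) ≡ sum f
sum-by-letter f v = begin
  sum (λ x → sum (λ r → f r * 𝟙 (v r Fin.≟ x))) ≡⟨ ∑-comm (λ x r → f r * 𝟙 (v r Fin.≟ x)) ⟩
  sum (λ r → sum (λ x → f r * 𝟙 (v r Fin.≟ x))) ≡⟨ sum-cong-≗ collapse ⟩
  sum f                                         ∎
  where
  open ≡-Reasoning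
  collapse : ∀ r → sum (λ x → f r * 𝟙 (v r Fin.≟ x)) ≡ f r
  collapse r = trans (sym (*-distribˡ-sum (f r) (λ x → 𝟙 (v r Fin.≟ x))))
    (trans (cong (f r *_) (sum-𝟙 (v r))) (*-identityʳ (f r)))

sum-occ : ∀ {a n} (v : Vector (Fin a) n) → sum (λ x → occ x v) ≡ n
sum-occ {n = n} v = begin
  sum (λ x → occ x v)                             ≡⟨ sum-cong-≗ (λ x → sum-cong-≗ (λ r → *-identityˡ (𝟙 (v r Fin.≟ x)))) ⟨
  sum (λ x → sum (λ r → 1 * 𝟙 (v r Fin.≟ x)))     ≡⟨ sum-by-letter (λ _ → 1) v ⟩
  sum {n} (λ _ → 1)                               ≡⟨ trans (sum-const n 1) (*-identityʳ n) ⟩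
  n                                               ∎
  where open ≡-Reasoning

f[r]≤sum : ∀ {n} (f : Vector ℕ n) r → f r ≤ sum f
f[r]≤sum {suc n} f r = ≤-trans (m≤m+n (f r) _) (≤-reflexive (sym (sum-remove {i = r} f)))

-- Split the occurrences of `x` in `v` by the letter of `w` at the same place: each of the a parts
-- is nonempty.
covered⇒a≤occ : ∀ {a n} {x : Fin a} (v w : Vector (Fin a) n) →
                (∀ y → ∃[ r ] v r ≡ x × w r ≡ y) → a ≤ occ x v
covered⇒a≤occ {a} {n} {x} v w covered = begin
  a                                                        ≡⟨ trans (sum-const a 1) (*-identityʳ a) ⟨
  sum {a} (λ _ → 1)                                        ≤⟨ sum-mono-≤ hit ⟩
  sum (λ y → sum (λ r → 𝟙 (v r Fin.≟ x) * 𝟙 (w r Fin.≟ y))) ≡⟨ sum-by-letter (λ r → 𝟙 (v r Fin.≟ x)) w ⟩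
  occ x v                                                  ∎
  where
  open ≤-Reasoning
  𝟙≡1 : ∀ {i j : Fin a} → i ≡ j → 𝟙 (i Fin.≟ j) ≡ 1
  𝟙≡1 {i} {j} i≡j with i Fin.≟ j
  ... | yes _  = refl
  ... | no i≢j = contradiction i≡j i≢j

  hit : ∀ y → 1 ≤ sum (λ r → 𝟙 (v r Fin.≟ x) * 𝟙 (w r Fin.≟ y))
  hit y with covered y
  ... | r , vr≡x , wr≡y = ≤-trans (≤-reflexive (sym (cong₂ _*_ (𝟙≡1 vr≡x) (𝟙≡1 wr≡y))))
    (f[r]≤sum (λ r → 𝟙 (v r Fin.≟ x) * 𝟙 (w r Fin.≟ y)) r)

minimum : ∀ {k} (f : Vector ℕ (suc k)) → ∃[ i ] ∀ j → f i ≤ f j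
minimum {zero}  f = Fin.zero , λ { Fin.zero → ≤-refl }
minimum {suc k} f with minimum (f ∘ Fin.suc)
... | i , least with ≤-total (f Fin.zero) (f (Fin.suc i))
...   | inj₁ f0≤fi = Fin.zero , λ { Fin.zero → ≤-refl ; (Fin.suc j) → ≤-trans f0≤fi (least j) }
...   | inj₂ fi≤f0 = Fin.suc i , λ { Fin.zero → fi≤f0 ; (Fin.suc j) → least j }

-- The two smallest values p ≤ q average at most the overall mean: the sum is at least p + (a-1)q,
-- and 2(p + (a-1)q) exceeds a(p+q) by (a-2)(q-p) ≥ 0.
twoSmallest : ∀ {a} (f : Vector ℕ a) → 2 ≤ a →
              ∃[ x ] ∃[ y ] x ≢ y × f x ≤ f y × a * (f x + f y) ≤ 2 * sum f
twoSmallest {1} f (s≤s ())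
twoSmallest {suc (suc k)} f _ with minimum f
... | x , x-least with minimum (removeAt f x)
...   | j , j-least = x , punchIn x j , (λ x≡y → Finₚ.punchInᵢ≢i x j (sym x≡y)) , p≤q , (begin
  (2 + k) * (p + q)            ≡⟨ expand k p q ⟩
  2 * p + k * p + (2 + k) * q  ≤⟨ +-monoˡ-≤ ((2 + k) * q) (+-monoʳ-≤ (2 * p) (*-monoʳ-≤ k p≤q)) ⟩
  2 * p + k * q + (2 + k) * q  ≡⟨ collect k p q ⟩
  2 * (p + (1 + k) * q)        ≤⟨ *-monoʳ-≤ 2 (+-monoʳ-≤ p rest) ⟩
  2 * (p + sum (removeAt f x)) ≡⟨ cong (2 *_) (sum-remove {i = x} f) ⟨
  2 * sum f                    ∎)
  where
  open ≤-Reasoning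
  p q : ℕ
  p = f x
  q = f (punchIn x j)

  p≤q : p ≤ q
  p≤q = x-least (punchIn x j)

  rest : (1 + k) * q ≤ sum (removeAt f x)
  rest = ≤-trans (≤-reflexive (sym (sum-const (1 + k) q))) (sum-mono-≤ j-least)

  expand : ∀ k p q → (2 + k) * (p + q) ≡ 2 * p + k * p + (2 + k) * q
  expand = solve-∀
  collect : ∀ k p q → 2 * p + k * q + (2 + k) * q ≡ 2 * (p + (1 + k) * q)
  collect = solve-∀

-- Places ⌈n/a⌉ in the range where row n of Pascal's triangle increases, as `C-monoʳ-≤` demands. For
-- a = 2 and odd n there is equality.
2*⌈n/a⌉≤n+1 : ∀ {a} n .{{_ : NonZero a}} → 2 ≤ a → 2 * ⌈ n / a ⌉ ≤ suc n
2*⌈n/a⌉≤n+1 {1} n (s≤s ())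
2*⌈n/a⌉≤n+1 {suc (suc d)} n _ = bound ⌈ n / (2 + d) ⌉ (m/n*n≤m (n + suc d) (2 + d))
  where
  open ≤-Reasoning
  expand : ∀ c d → 2 * suc c + (d + c * d) ≡ suc c * (2 + d)
  expand = solve-∀
  shift : ∀ n d → n + suc d ≡ suc n + d
  shift = solve-∀

  bound : ∀ c → c * (2 + d) ≤ n + suc d → 2 * c ≤ suc n
  bound zero    _ = z≤n
  bound (suc c) h = +-cancelʳ-≤ d (2 * suc c) (suc n) (begin
    2 * suc c + d           ≤⟨ +-monoʳ-≤ (2 * suc c) (m≤m+n d (c * d)) ⟩
    2 * suc c + (d + c * d) ≡⟨ expand c d ⟩
    suc c * (2 + d)         ≤⟨ h ⟩
    n + suc d               ≡⟨ shift n d ⟩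
    suc n + d               ∎)

p≤⌈n/a⌉ : ∀ {a p q} n .{{_ : NonZero a}} → p ≤ q → a * (p + q) ≤ 2 * n → p ≤ ⌈ n / a ⌉
p≤⌈n/a⌉ {a} {p} {q} n p≤q h = begin
  p             ≡⟨ m*n/n≡m p a ⟨
  p * a / a     ≤⟨ /-monoˡ-≤ a (≤-trans pa≤n (m≤m+n n (a ∸ 1))) ⟩
  ⌈ n / a ⌉     ∎
  where
  open ≤-Reasoning
  double : ∀ p a → 2 * (p * a) ≡ a * (p + p)
  double = solve-∀

  pa≤n : p * a ≤ n
  pa≤n = *-cancelˡ-≤ 2 (begin
    2 * (p * a) ≡⟨ double p a ⟩
    a * (p + p) ≤⟨ *-monoʳ-≤ a (+-monoʳ-≤ p p≤q) ⟩
    a * (p + q) ≤⟨ h ⟩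
    2 * n       ∎)

aC2*[p+q]Cp≤nC⌈n/a⌉ : ∀ {a p q n} .{{_ : NonZero a}} → 2 ≤ a → a ≤ p → p ≤ q → a * (p + q) ≤ 2 * n →
                       (a C 2) * ((p + q) C p) ≤ n C ⌈ n / a ⌉
aC2*[p+q]Cp≤nC⌈n/a⌉ {a} {p} {q} {n} 2≤a a≤p p≤q h =
  ≤-trans (*-cancelˡ-≤ (2 ^ p) {{m^n≢0 2 p}} (begin
    2 ^ p * ((a C 2) * ((p + q) C p)) ≡⟨ *-assoc (2 ^ p) (a C 2) ((p + q) C p) ⟨
    2 ^ p * (a C 2) * ((p + q) C p)   ≤⟨ *-monoˡ-≤ ((p + q) C p) (2^p*aC2≤a^p 2≤a a≤p) ⟩
    a ^ p * ((p + q) C p)             ≤⟨ a^p*sCp≤2^p*nCp 2≤a p (p + q) n h ⟩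
    2 ^ p * (n C p)                   ∎))
  (C-monoʳ-≤ (p≤⌈n/a⌉ n p≤q h) (2*⌈n/a⌉≤n+1 n 2≤a))
  where open ≤-Reasoning

-- By `orders-value` the share of `orders` in n! is p! q! / (p+q)!, so the hypothesis says that this
-- share is at least K / M, with denominators cleared.
orders-large : ∀ {a n} M K {x y : Fin a} (v : Vector (Fin a) n) → x ≢ y →
               K * (occ x v + occ y v) ! ≤ M * (occ x v ! * occ y v !) → K * n ! ≤ M * orders x y v
orders-large {n = n} M K {x} {y} v x≢y h =
  *-cancelʳ-≤ (K * n !) (M * o) f {{m*n≢0 (occ x v !) (occ y v !) {{(occ x v) !≢0}} {{(occ y v) !≢0}}}} (begin
    K * n ! * f                       ≡⟨ shuffle K (n !) f ⟩
    K * (f * n !)                     ≡⟨ cong (K *_) (orders-value {v = v} x≢y refl refl) ⟨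
    K * (o * (occ x v + occ y v) !)   ≡⟨ shuffle′ K o ((occ x v + occ y v) !) ⟩
    K * (occ x v + occ y v) ! * o     ≤⟨ *-monoˡ-≤ o h ⟩
    M * f * o                         ≡⟨ swap M f o ⟩
    M * o * f                         ∎)
  where
  open ≤-Reasoning
  o f : ℕ
  o = orders x y v
  f = occ x v ! * occ y v !

  shuffle : ∀ k n f → k * n * f ≡ k * (f * n)
  shuffle = solve-∀
  shuffle′ : ∀ k o s → k * (o * s) ≡ k * s * o
  shuffle′ = solve-∀
  swap : ∀ m f o → m * f * o ≡ m * o * f
  swap = solve-∀

-- The set pairs are indexed by `Fin (m * 2)`: a vector and an orientation, (X , Y) or (Y , X). The
-- two orientations produce the factor 2, and `bollobás` is applied with K = C(a,2) and M = C(n,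
-- ⌈n/a⌉).
perfect⇒size≤ : ∀ {a n m} .{{_ : NonZero a}} → 2 ≤ a → PerfectSize a n m → m * (2 * (a C 2)) ≤ n C ⌈ n / a ⌉
perfect⇒size≤ {a} {n} {m} 2≤a (𝒱 , mkPerfect _ 2≤m covers) = begin
  m * (2 * (a C 2))                         ≡⟨ *-assoc m 2 (a C 2) ⟨
  m * 2 * (a C 2)                           ≡⟨ cong (_* (a C 2)) (length-tabulate pair) ⟨
  length (List.tabulate pair) * (a C 2)     ≤⟨ bollobás (n C ⌈ n / a ⌉) (a C 2)
                                                 (AllPairsₚ.tabulate⁺ λ k≢l → cross (k≢l ∘ remQuot-injective))
                                                 (Allₚ.tabulate⁺ λ k → large (remQuot 2 k)) ⟩
  n C ⌈ n / a ⌉                             ∎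
  where
  open ≤-Reasoning
  v : Fin m → Vector (Fin a) n
  v i = lookup (lookup 𝒱 i)

  covered : ∀ {i j} → i ≢ j → ∀ x y → ∃[ r ] v i r ≡ x × v j r ≡ y
  covered {i} {j} i≢j x y with Finₚ.<-cmp i j
  ... | tri≈ _ i≡j _ = contradiction i≡j i≢j
  ... | tri< i<j _ _ with covers i j i<j (x ∷ y ∷ [])
  ...   | r , refl = r , refl , refl
  -- `covers` takes the vectors in increasing order of index, so the string is reversed.
  covered {i} {j} i≢j x y | tri> _ _ j<i with covers j i j<i (y ∷ x ∷ [])
  ...   | r , refl = r , refl , refl

  -- A second vector is what forces every letter to occur in `v i`, and to occur at least a times.
  other : ∀ {m} → 2 ≤ m → (i : Fin m) → ∃[ j ] i ≢ j
  other (s≤s (s≤s _)) Fin.zero    = Fin.suc Fin.zero , λ ()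
  other (s≤s (s≤s _)) (Fin.suc i) = Fin.zero , λ ()

  smallest : ∀ i → _
  smallest i = twoSmallest (λ x → occ x (v i)) 2≤a

  x y : Fin m → Fin a
  x i = proj₁ (smallest i)
  y i = proj₁ (proj₂ (smallest i))

  x≢y : ∀ i → x i ≢ y i
  x≢y i = proj₁ (proj₂ (proj₂ (smallest i)))

  p q : Fin m → ℕ
  p i = occ (x i) (v i)
  q i = occ (y i) (v i)

  setPair : Fin m × Fin 2 → SetPair a n
  setPair (i , Fin.zero)  = x i , y i , v i
  setPair (i , Fin.suc _) = y i , x i , v i

  pair : Fin (m * 2) → SetPair a n
  pair k = setPair (remQuot 2 k)

  remQuot-injective : ∀ {k l} → remQuot {m} 2 k ≡ remQuot 2 l → k ≡ l
  remQuot-injective {k} {l} eq = trans (sym (Finₚ.combine-remQuot {m} 2 k))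
    (trans (cong (λ (i , s) → combine i s) eq) (Finₚ.combine-remQuot {m} 2 l))

  occurs : ∀ i z → ∃[ r ] v i r ≡ z × v i r ≡ z
  occurs i z with covered (proj₂ (other 2≤m i)) z z
  ... | r , vr≡z , _ = r , vr≡z , vr≡z

  cross-≢ : ∀ {i j} → i ≢ j → ∀ s t → Cross (setPair (i , s)) (setPair (j , t))
  cross-≢ i≢j Fin.zero    Fin.zero    = covered i≢j _ _ , covered (i≢j ∘ sym) _ _
  cross-≢ i≢j Fin.zero    (Fin.suc _) = covered i≢j _ _ , covered (i≢j ∘ sym) _ _
  cross-≢ i≢j (Fin.suc _) Fin.zero    = covered i≢j _ _ , covered (i≢j ∘ sym) _ _
  cross-≢ i≢j (Fin.suc _) (Fin.suc _) = covered i≢j _ _ , covered (i≢j ∘ sym) _ _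

  -- (X , Y) and (Y , X) cross because the required intersections are X ∩ X and Y ∩ Y, both
  -- nonempty.
  cross-≡ : ∀ i {s t} → s ≢ t → Cross (setPair (i , s)) (setPair (i , t))
  cross-≡ i {Fin.zero}         {Fin.zero}         s≢t = contradiction refl s≢t
  cross-≡ i {Fin.zero}         {Fin.suc Fin.zero} _   = occurs i (x i) , occurs i (y i)
  cross-≡ i {Fin.suc Fin.zero} {Fin.zero}         _   = occurs i (y i) , occurs i (x i)
  cross-≡ i {Fin.suc Fin.zero} {Fin.suc Fin.zero} s≢t = contradiction refl s≢t

  cross : ∀ {k l} → k ≢ l → Cross (setPair k) (setPair l)
  cross {i , s} {j , t} k≢l with i Fin.≟ j
  ... | yes refl = cross-≡ i (k≢l ∘ cong (i ,_))
  ... | no i≢j   = cross-≢ i≢j s t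

  M : ℕ
  M = n C ⌈ n / a ⌉

  binomial-bound : ∀ i → (a C 2) * (p i + q i) ! ≤ M * (p i ! * q i !)
  binomial-bound i = begin
    (a C 2) * (p i + q i) !                                ≡⟨ cong ((a C 2) *_) ([p+q]Cp*p!*q!≡[p+q]! (p i) (q i)) ⟨
    (a C 2) * (((p i + q i) C p i) * (p i ! * q i !))      ≡⟨ *-assoc (a C 2) ((p i + q i) C p i) (p i ! * q i !) ⟨
    (a C 2) * ((p i + q i) C p i) * (p i ! * q i !)        ≤⟨ *-monoˡ-≤ (p i ! * q i !)
                                                                (aC2*[p+q]Cp≤nC⌈n/a⌉ 2≤a a≤p p≤q a[p+q]≤2n) ⟩
    M * (p i ! * q i !)                                    ∎
    where
    p≤q : p i ≤ q i
    p≤q = proj₁ (proj₂ (proj₂ (proj₂ (smallest i))))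

    a[p+q]≤2n : a * (p i + q i) ≤ 2 * n
    a[p+q]≤2n = subst (λ s → a * (p i + q i) ≤ 2 * s) (sum-occ (v i)) (proj₂ (proj₂ (proj₂ (proj₂ (smallest i)))))

    a≤p : a ≤ p i
    a≤p = covered⇒a≤occ (v i) (v (proj₁ (other 2≤m i))) (covered (proj₂ (other 2≤m i)) (x i))

  large : ∀ k → let (x , y , v) = setPair k in (a C 2) * n ! ≤ M * orders x y v
  large (i , Fin.zero)  = orders-large M (a C 2) (v i) (x≢y i) (binomial-bound i)
  large (i , Fin.suc _) = orders-large M (a C 2) (v i) (x≢y i ∘ sym)
    (subst₂ (λ s f → (a C 2) * s ! ≤ M * f) (+-comm (p i) (q i)) (*-comm (p i !) (q i !)) (binomial-bound i))

-- The lower bound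

choose : (n k : ℕ) → List (Subset n)
choose zero    zero    = [] ∷ []
choose zero    (suc k) = []
choose (suc n) zero    = List.map (outside ∷_) (choose n zero)
choose (suc n) (suc k) = List.map (inside ∷_) (choose n k) ++ List.map (outside ∷_) (choose n (suc k))

length-choose : ∀ n k → length (choose n k) ≡ n C k
length-choose zero    zero    = refl
length-choose zero    (suc k) = refl
length-choose (suc n) zero    = trans (length-map (outside ∷_) (choose n zero)) (length-choose n zero)
length-choose (suc n) (suc k) = begin
  length (choose (suc n) (suc k))
    ≡⟨ length-++ (List.map (inside ∷_) (choose n k)) ⟩
  length (List.map (inside ∷_) (choose n k)) + length (List.map (outside ∷_) (choose n (suc k)))
    ≡⟨ cong₂ _+_ (trans (length-map _ (choose n k)) (length-choose n k))
                 (trans (length-map _ (choose n (suc k))) (length-choose n (suc k))) ⟩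
  n C k + n C suc k
    ≡⟨ nCk+nC[k+1]≡[n+1]C[k+1] n k ⟩
  suc n C suc k ∎
  where open ≡-Reasoning

choose-size : ∀ n k → All (λ (S : Subset n) → ∣ S ∣ ≡ k) (choose n k)
choose-size zero    zero    = refl ∷ []
choose-size zero    (suc k) = []
choose-size (suc n) zero    = Allₚ.map⁺ (choose-size n zero)
choose-size (suc n) (suc k) =
  Allₚ.++⁺ (Allₚ.map⁺ (All.map (cong suc) (choose-size n k))) (Allₚ.map⁺ (choose-size n (suc k)))

choose-unique : ∀ n k → Unique (choose n k)
choose-unique zero    zero    = [] ∷ []
choose-unique zero    (suc k) = []
choose-unique (suc n) zero    = Uniqueₚ.map⁺ ∷-injectiveʳ (choose-unique n zero)
choose-unique (suc n) (suc k) =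
  Uniqueₚ.++⁺ (Uniqueₚ.map⁺ ∷-injectiveʳ (choose-unique n k))
    (Uniqueₚ.map⁺ ∷-injectiveʳ (choose-unique n (suc k))) disjoint
  where
  disjoint : ∀ {S} → ¬ (S ∈ List.map (inside ∷_) (choose n k) × S ∈ List.map (outside ∷_) (choose n (suc k)))
  disjoint (S∈ , S∈′) with ∈-map⁻ (inside ∷_) S∈ | ∈-map⁻ (outside ∷_) S∈′
  ... | _ , _ , refl | _ , _ , ()

Meets : ∀ {n} → Subset n → Subset n → Bool → Bool → Set
Meets S T s t = ∃[ i ] lookup S i ≡ s × lookup T i ≡ t

meets-suc : ∀ {n s t s′ t′} {S T : Subset n} → Meets S T s t → Meets (s′ ∷ S) (t′ ∷ T) s t
meets-suc (i , eq) = Fin.suc i , eq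

-- The sizes are compared by ≤ and not by equality so that the induction can pass an element lying
-- only in `T`. After such an element the tails have different sizes, hence differ.
difference : ∀ {n} (S T : Subset n) → ∣ T ∣ ≤ ∣ S ∣ → S ≢ T → Meets S T inside outside
difference []            []            _ S≢T = contradiction refl S≢T
difference (inside  ∷ S) (outside ∷ T) _ _   = Fin.zero , refl , refl
difference (inside  ∷ S) (inside  ∷ T) h S≢T = meets-suc (difference S T (s≤s⁻¹ h) (S≢T ∘ cong (inside ∷_)))
difference (outside ∷ S) (outside ∷ T) h S≢T = meets-suc (difference S T h (S≢T ∘ cong (outside ∷_)))
difference (outside ∷ S) (inside  ∷ T) h S≢T = meets-suc (difference S T (<⇒≤ h) λ S≡T → <-irrefl (cong ∣_∣ (sym S≡T)) h)

missed : ∀ {n} (S T : Subset n) → ∣ S ∣ + ∣ T ∣ < n → Meets S T outside outside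
missed (outside ∷ S) (outside ∷ T) _ = Fin.zero , refl , refl
missed (inside  ∷ S) (outside ∷ T) h = meets-suc (missed S T (s≤s⁻¹ h))
missed (outside ∷ S) (inside  ∷ T) h = meets-suc (missed S T (s≤s⁻¹ (≤-trans (≤-reflexive (cong suc (sym (+-suc ∣ S ∣ ∣ T ∣)))) h)))
missed (inside  ∷ S) (inside  ∷ T) h = meets-suc (missed S T (≤-trans (s≤s (+-monoʳ-≤ ∣ S ∣ (n≤1+n ∣ T ∣))) (s≤s⁻¹ h)))

-- Qualitative independence of two sets: all four cells of their Venn diagram are nonempty.
Independent : ∀ {n} → Subset n → Subset n → Set
Independent S T = ∀ s t → Meets S T s t

-- The added point lies in both sets, equal sizes of distinct sets give both differences, and 2k < n
-- leaves a point outside the union.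
independent : ∀ {n k} (S T : Subset n) → ∣ S ∣ ≡ k → ∣ T ∣ ≡ k → k + k < n → S ≢ T →
              Independent (inside ∷ S) (inside ∷ T)
independent S T S≡k T≡k 2k<n S≢T true  true  = Fin.zero , refl , refl
independent S T S≡k T≡k 2k<n S≢T true  false = meets-suc (difference S T (≤-reflexive (trans T≡k (sym S≡k))) S≢T)
independent S T S≡k T≡k 2k<n S≢T false true  with difference T S (≤-reflexive (trans S≡k (sym T≡k))) (S≢T ∘ sym)
... | i , i∈T , i∉S = Fin.suc i , i∉S , i∈T
independent S T S≡k T≡k 2k<n S≢T false false =
  meets-suc (missed S T (≤-trans (s≤s (≤-reflexive (cong₂ _+_ S≡k T≡k))) 2k<n))

pairs : ∀ a → List (Fin a × Fin a)
pairs zero    = []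
pairs (suc a) = List.map (λ y → Fin.zero , Fin.suc y) (allFin a) ++ List.map (Product.map Fin.suc Fin.suc) (pairs a)

length-pairs : ∀ a → length (pairs a) ≡ a C 2
length-pairs zero    = refl
length-pairs (suc a) = begin
  length (pairs (suc a))
    ≡⟨ length-++ (List.map (λ y → Fin.zero {a} , Fin.suc y) (allFin a)) ⟩
  length (List.map (λ y → Fin.zero {a} , Fin.suc y) (allFin a)) +
    length (List.map (Product.map Fin.suc Fin.suc) (pairs a))
    ≡⟨ cong₂ _+_ (trans (length-map _ (allFin a)) (trans (length-tabulate {n = a} (λ i → i)) (sym (nC1≡n a))))
                 (trans (length-map _ (pairs a)) (length-pairs a)) ⟩
  a C 1 + a C 2
    ≡⟨ nCk+nC[k+1]≡[n+1]C[k+1] a 1 ⟩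
  suc a C 2 ∎
  where open ≡-Reasoning

∈-pairs : ∀ {a} {x y : Fin a} → x <ᶠ y → (x , y) ∈ pairs a
∈-pairs {suc a} {Fin.zero}  {Fin.suc y} _   = ∈-++⁺ˡ (∈-map⁺ _ (∈-allFin y))
∈-pairs {suc a} {Fin.suc x} {Fin.suc y} x<y = ∈-++⁺ʳ _ (∈-map⁺ _ (∈-pairs (s≤s⁻¹ x<y)))

pick : ∀ {a} → Bool → Fin a × Fin a → Fin a
pick s (x , y) = if s then x else y

-- Distinct letters use their own block. A repeated letter uses any block containing it, read on the
-- same side for both vectors.
pair-with : ∀ {a} → 2 ≤ a → ∀ x y → ∃[ j ] ∃[ s ] ∃[ t ]
            pick s (List.lookup (pairs a) j) ≡ x × pick t (List.lookup (pairs a) j) ≡ y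
pair-with {a} 2≤a x y with Finₚ.<-cmp x y
... | tri< x<y _ _ = Any.index (∈-pairs x<y) , true , false , at true , at false
  where
  at : ∀ s → pick s (List.lookup (pairs a) (Any.index (∈-pairs x<y))) ≡ pick s (x , y)
  at s = cong (pick s) (sym (Anyₚ.lookup-index (∈-pairs x<y)))
... | tri> _ _ y<x = Any.index (∈-pairs y<x) , false , true , at false , at true
  where
  at : ∀ s → pick s (List.lookup (pairs a) (Any.index (∈-pairs y<x))) ≡ pick s (y , x)
  at s = cong (pick s) (sym (Anyₚ.lookup-index (∈-pairs y<x)))
-- Index zero of `pairs` is the pair (0 , 1), which has the letter 0 on its `true` side; a positive
-- letter x is found on the `false` side of (0 , x).
pair-with {suc (suc _)} _ Fin.zero    _ | tri≈ _ refl _ = Fin.zero , true , true , refl , refl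
pair-with {suc (suc a)} _ (Fin.suc x) _ | tri≈ _ refl _ = Any.index (∈-pairs 0<x) , false , false , at , at
  where
  0<x : Fin.zero {suc a} <ᶠ Fin.suc x
  0<x = s≤s z≤n
  at : pick false (List.lookup (pairs _) (Any.index (∈-pairs 0<x))) ≡ Fin.suc x
  at = cong (pick false) (sym (Anyₚ.lookup-index (∈-pairs 0<x)))
pair-with {1} (s≤s ()) _ _ | tri≈ _ _ _

AllPairs-lookup : ∀ {A : Set} {R : A → A → Set} {xs} → AllPairs R xs → ∀ {i j} → i <ᶠ j →
                  R (List.lookup xs i) (List.lookup xs j)
AllPairs-lookup (Rx ∷ _)  {Fin.zero}  {Fin.suc j} _   = All.lookup Rx (∈-lookup j)
AllPairs-lookup (_  ∷ Rs) {Fin.suc i} {Fin.suc j} i<j = AllPairs-lookup Rs (s≤s⁻¹ i<j)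

-- Coordinates beyond the length pairs * w used ones repeat them cyclically.
word : ∀ {a} n {w} .{{_ : NonZero (length (pairs a) * w)}} → Subset w → Vec (Fin a) n
word {a} n {w} S = tabulate λ r → let (j , i) = remQuot w (toℕ r mod (length (pairs a) * w))
                                  in pick (lookup S i) (List.lookup (pairs a) j)

word-covers : ∀ {a n w} .{{_ : NonZero (length (pairs a) * w)}} → 2 ≤ a → length (pairs a) * w ≤ n →
              (S T : Subset w) → Independent S T → ∀ x y →
              ∃[ r ] lookup (word {a} n S) r ≡ x × lookup (word {a} n T) r ≡ y
word-covers {a} {n} {w} 2≤a fits S T ind x y with pair-with 2≤a x y
... | j , s , t , refl , refl with ind s t
...   | i , refl , refl = r , at S , at T
  where
  c : Fin (length (pairs a) * w)
  c = combine j i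

  r : Fin n
  r = inject≤ c fits

  -- `c` is below the modulus, so the cyclic repetition leaves it unchanged.
  r-mod : toℕ r mod (length (pairs a) * w) ≡ c
  r-mod = Finₚ.toℕ-injective (begin
    toℕ (toℕ r mod (length (pairs a) * w)) ≡⟨ Finₚ.toℕ-fromℕ< _ ⟩
    toℕ r % (length (pairs a) * w)         ≡⟨ cong (_% (length (pairs a) * w)) (Finₚ.toℕ-inject≤ c fits) ⟩
    toℕ c % (length (pairs a) * w)         ≡⟨ m<n⇒m%n≡m (Finₚ.toℕ<n c) ⟩
    toℕ c                                  ∎)
    where open ≡-Reasoning

  at : ∀ U → lookup (word {a} n U) r ≡ pick (lookup U i) (List.lookup (pairs a) j)
  at U = trans (lookup∘tabulate _ r)
    (cong (λ (j , i) → pick (lookup U i) (List.lookup (pairs a) j))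
      (trans (cong (remQuot {length (pairs a)} w) r-mod) (Finₚ.remQuot-combine j i)))

perfectFamily : ∀ {a n w} .{{_ : NonZero (length (pairs a) * w)}} → 2 ≤ a → length (pairs a) * w ≤ n →
                (𝒮 : List (Subset w)) → AllPairs Independent 𝒮 → 2 ≤ length 𝒮 → PerfectSize a n (length 𝒮)
perfectFamily {a} {n} {w} 2≤a fits 𝒮 ind 2≤m = tabulate v , mkPerfect (VecUniqueₚ.tabulate⁺ injective) 2≤m covers
  where
  v : Fin (length 𝒮) → Vec (Fin a) n
  v i = word n (List.lookup 𝒮 i)

  covered : ∀ {i j} → i <ᶠ j → ∀ x y → ∃[ r ] lookup (v i) r ≡ x × lookup (v j) r ≡ y
  covered {i} {j} i<j = word-covers 2≤a fits (List.lookup 𝒮 i) (List.lookup 𝒮 j) (AllPairs-lookup ind i<j)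

  distinctLetters : ∀ {a} → 2 ≤ a → ∃[ x ] ∃[ y ] (Fin a ∋ x) ≢ y
  distinctLetters {suc (suc _)} _ = Fin.zero , Fin.suc Fin.zero , λ ()
  distinctLetters {1} (s≤s ())

  -- Distinctness follows from covering: some coordinate realises a string of two different letters.
  v≢v : ∀ {i j} → i <ᶠ j → v i ≢ v j
  v≢v i<j vi≡vj with distinctLetters 2≤a
  ... | x , y , x≢y with covered i<j x y
  ...   | r , vi≡x , vj≡y = x≢y (trans (sym vi≡x) (trans (cong (λ u → lookup u r) vi≡vj) vj≡y))

  injective : ∀ {i j} → v i ≡ v j → i ≡ j
  injective {i} {j} vi≡vj with Finₚ.<-cmp i j
  ... | tri< i<j _ _ = contradiction vi≡vj (v≢v i<j)
  ... | tri≈ _ i≡j _ = i≡j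
  ... | tri> _ _ j<i = contradiction (sym vi≡vj) (v≢v j<i)

  covers : (i j : Fin (length 𝒮)) → i <ᶠ j → (α : Vec (Fin a) 2) →
           ∃[ r ] lookup (lookup (tabulate v) i) r ∷ lookup (lookup (tabulate v) j) r ∷ [] ≡ α
  covers i j i<j (x ∷ y ∷ []) with covered i<j x y
  ... | r , vi≡x , vj≡y = r , cong₂ (λ x y → x ∷ y ∷ [])
    (trans (cong (λ u → lookup u r) (lookup∘tabulate v i)) vi≡x)
    (trans (cong (λ u → lookup u r) (lookup∘tabulate v j)) vj≡y)

halfFamily : (k : ℕ) → List (Subset (2 * suc k))
halfFamily k = List.map (inside ∷_) (choose (k + suc (k + 0)) k)

-- With N = 2k+1, the symmetry C(N,k) = C(N,k+1) makes the doubled count a Pascal sum.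
2*length-halfFamily : ∀ k → 2 * length (halfFamily k) ≡ (2 * suc k) C suc k
2*length-halfFamily k = begin
  2 * length (halfFamily k)      ≡⟨ cong (2 *_) (trans (length-map _ (choose N k)) (length-choose N k)) ⟩
  2 * (N C k)                    ≡⟨ cong (_+_ (N C k)) (+-identityʳ (N C k)) ⟩
  N C k + N C k                  ≡⟨ cong (_+_ (N C k)) (nCk≡nC[n∸k] {k} {N} (m≤m+n k _)) ⟩
  N C k + N C (N ∸ k)            ≡⟨ cong (λ i → N C k + N C i)
                                       (trans (m+n∸m≡n k (suc (k + 0))) (cong suc (+-identityʳ k))) ⟩
  N C k + N C suc k              ≡⟨ nCk+nC[k+1]≡[n+1]C[k+1] N k ⟩
  suc N C suc k                  ∎
  where
  open ≡-Reasoning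
  N : ℕ
  N = k + suc (k + 0)

halfFamily-independent : ∀ k → AllPairs Independent (halfFamily k)
halfFamily-independent k = AllPairsₚ.map⁺ (go (choose-size N k) (choose-unique N k))
  where
  N : ℕ
  N = k + suc (k + 0)

  2k<N : k + k < N
  2k<N = ≤-reflexive (trans (sym (+-suc k k)) (cong (λ i → k + suc i) (sym (+-identityʳ k))))

  go : ∀ {𝒮 : List (Subset N)} → All (λ S → ∣ S ∣ ≡ k) 𝒮 → Unique 𝒮 →
       AllPairs (λ S T → Independent (inside ∷ S) (inside ∷ T)) 𝒮
  go [] [] = []
  go (S≡k ∷ sizes) (S≢ ∷ unique) =
    All.zipWith (λ (T≡k , S≢T) → independent _ _ S≡k T≡k 2k<N S≢T) (sizes , S≢) ∷ go sizes unique

[2k]Ck≤2*p : ∀ {a n} → 2 ≤ a → a ^ 2 ≤ n → ∀ k → (a C 2) * (2 * k) ≤ n → (2 * k) C k ≤ 2 * p⟨ a ,2, n ⟩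
[2k]Ck≤2*p {a} {n} 2≤a a²≤n zero _ =
  ≤-trans (≤-trans (s≤s z≤n) (p-upperBound (perfectPair 2≤a a²≤n))) (m≤m+n p⟨ a ,2, n ⟩ _)
[2k]Ck≤2*p {a} {n} 2≤a a²≤n (suc k) fits =
  ≤-trans (≤-reflexive (sym (2*length-halfFamily k))) (*-monoʳ-≤ 2 size≤p)
  where
  fits′ : length (pairs a) * (2 * suc k) ≤ n
  fits′ = subst (λ b → b * (2 * suc k) ≤ n) (sym (length-pairs a)) fits

  instance
    _ : NonZero (length (pairs a) * (2 * suc k))
    _ = m*n≢0 (length (pairs a)) (2 * suc k)
      {{subst NonZero (sym (length-pairs a)) (m*n≢0⇒n≢0 2 {{2≤a⇒2b≢0 2≤a}})}}

  size≤p : length (halfFamily k) ≤ p⟨ a ,2, n ⟩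
  size≤p with 2 ≤? length (halfFamily k)
  ... | yes 2≤m = p-upperBound (perfectFamily 2≤a fits′ (halfFamily k) (halfFamily-independent k) 2≤m)
  -- This happens when `halfFamily` has a single member, at k = 0; `perfectPair` then supplies a set
  -- of size 2.
  ... | no  2≰m = ≤-trans (<⇒≤ (≰⇒> 2≰m)) (p-upperBound (perfectPair 2≤a a²≤n))

-- From natural numbers to rationals

-- Unnormalised rationals avoid the reduction to lowest terms, so that ≤ becomes
-- cross-multiplication. `mkℚᵘ` stores the denominator minus one: the right side is c/(d+1).
toℚᵘ-1/d*c/1 : ∀ d c → toℚᵘ ((+ 1 /ℚ suc d) *ℚ (+ c /ℚ 1)) ≃ᵘ mkℚᵘ (+ c) d
toℚᵘ-1/d*c/1 d c = ℚᵘₚ.≃-trans (ℚₚ.toℚᵘ-homo-* (+ 1 /ℚ suc d) (+ c /ℚ 1))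
  (ℚᵘₚ.≃-trans (ℚᵘₚ.*-cong (ℚₚ.toℚᵘ-fromℚᵘ (mkℚᵘ (+ 1) d)) (ℚₚ.toℚᵘ-fromℚᵘ (mkℚᵘ (+ c) 0)))
    (ℚᵘₚ.≃-reflexive (cong₂ mkℚᵘ (ℤₚ.*-identityˡ (+ c)) (*-identityʳ d))))

toℚᵘ-m/1 : ∀ m → toℚᵘ (+ m /ℚ 1) ≃ᵘ mkℚᵘ (+ m) 0
toℚᵘ-m/1 m = ℚₚ.toℚᵘ-fromℚᵘ (mkℚᵘ (+ m) 0)

c≤m*d⇒1/d*c≤m : ∀ c m d .{{_ : NonZero d}} → c ≤ m * d → (+ 1 /ℚ d) *ℚ (+ c /ℚ 1) ≤ℚ + m /ℚ 1
c≤m*d⇒1/d*c≤m c m (suc d) h = ℚₚ.toℚᵘ-cancel-≤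
  (ℚᵘₚ.≤-respˡ-≃ (ℚᵘₚ.≃-sym (toℚᵘ-1/d*c/1 d c)) (ℚᵘₚ.≤-respʳ-≃ (ℚᵘₚ.≃-sym (toℚᵘ-m/1 m))
    (*≤* (subst₂ ℤ._≤_ (sym (ℤₚ.*-identityʳ (+ c))) (ℤₚ.pos-* m (suc d)) (ℤ.+≤+ h)))))

m*d≤c⇒m≤1/d*c : ∀ c m d .{{_ : NonZero d}} → m * d ≤ c → + m /ℚ 1 ≤ℚ (+ 1 /ℚ d) *ℚ (+ c /ℚ 1)
m*d≤c⇒m≤1/d*c c m (suc d) h = ℚₚ.toℚᵘ-cancel-≤
  (ℚᵘₚ.≤-respʳ-≃ (ℚᵘₚ.≃-sym (toℚᵘ-1/d*c/1 d c)) (ℚᵘₚ.≤-respˡ-≃ (ℚᵘₚ.≃-sym (toℚᵘ-m/1 m))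
    (*≤* (subst₂ ℤ._≤_ (ℤₚ.pos-* m (suc d)) (sym (ℤₚ.*-identityʳ (+ c))) (ℤ.+≤+ h)))))

theorem4 : (a n : ℕ) (2≤a : 2 ≤ a) → a ^ 2 ≤ n →
  let instance
        a≢0 : NonZero a
        a≢0 = 2≤a⇒a≢0 2≤a
        2b≢0 : NonZero (2 * (a C 2))
        2b≢0 = 2≤a⇒2b≢0 2≤a
      b = a C 2
      k = n / (2 * b)
      p = + p⟨ a ,2, n ⟩ /ℚ 1
  in  (½ *ℚ (+ ((2 * k) C k) /ℚ 1) ≤ℚ p)
    × (p ≤ℚ (+ 1 /ℚ (2 * b)) *ℚ (+ (n C ⌈ n / a ⌉) /ℚ 1))
theorem4 a n 2≤a a²≤n =
    -- `½` unfolds to `+ 1 /ℚ 2`, so the lower bound is the case d = 2.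
    c≤m*d⇒1/d*c≤m ((2 * k) C k) p⟨ a ,2, n ⟩ 2
      (subst (((2 * k) C k) ≤_) (*-comm 2 p⟨ a ,2, n ⟩) ([2k]Ck≤2*p 2≤a a²≤n k blocks))
  , m*d≤c⇒m≤1/d*c (n C ⌈ n / a ⌉) p⟨ a ,2, n ⟩ (2 * (a C 2))
      (perfect⇒size≤ 2≤a (proj₁ (p-isMaximum 2≤a a²≤n)))
  where
  instance
    _ : NonZero a
    _ = 2≤a⇒a≢0 2≤a
    _ : NonZero (2 * (a C 2))
    _ = 2≤a⇒2b≢0 2≤a

  k : ℕ
  k = n / (2 * (a C 2))

  regroup : ∀ b k → b * (2 * k) ≡ k * (2 * b)
  regroup = solve-∀

  blocks : (a C 2) * (2 * k) ≤ n
  blocks = ≤-trans (≤-reflexive (regroup (a C 2) k)) (m/n*n≤m n (2 * (a C 2)))
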